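{- Let $G = \prod_{i=1}^t K_{n_i}$ (direct product), where $2 \leq n_1 \leq n_2 \leq \cdots \leq n_t$. If $t=1$, then $\mathrm{ir}(G)=1$. If $t=2$, then $\mathrm{ir}(G)=2$ if $n_1=2$ and $\mathrm{ir}(G)=3$ if $n_1\geq 3$. If $t=3$, then $\mathrm{ir}(G)=4$. For $t \geq 4$, we have $\mathrm{ir}(G) \geq \frac{1}{2}\left(t + \left\lfloor \frac{t-1}{n_1-1}\right\rfloor\right) + 1$.
   Context: The direct product $G\times H$ of graphs has vertex set $V(G)\times V(H)$, with $(g_1,h_1)$ adjacent to $(g_2,h_2)$ iff $g_1g_2\in E(G)$ and $h_1h_2\in E(H)$; thus vertices of $\prod_{i=1}^t K_{n_i}$ are tuples in $\prod_i\{0,\dots,n_i-1\}$, adjacent iff they differ in every coordinate. For a vertex $v$, $N[v]$ is its closed neighborhood, and for $S\subseteq V(G)$, $N[S]=\bigcup_{v\in S}N[v]$. A vertex $u$ is a private neighbor of $v\in S$ if $u\in N[v]\setminus N[S\setminus\{v\}]$ ($u=v$ allowed). A set $S$ is irredundant if every $v\in S$ has a private neighbor. The irredundance number $\mathrm{ir}(G)$ is the minimum size of a maximal (under inclusion) irredundant set. -}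

module Defs where

open import Data.Nat using (ℕ; zero; suc; _∸_; _≤_; s≤s; NonZero)
open import Data.Fin using (Fin)
open import Data.List using (List; []; _∷_)
open import Data.List.Membership.Propositional using (_∈_; _∉_)
open import Data.List.Relation.Binary.Subset.Propositional using (_⊆_)
open import Data.List.Relation.Unary.Unique.Propositional using (Unique)
open import Data.List using (length)
open import Data.Product using (_×_; _,_; ∃; ∃-syntax)
open import Data.Sum using (_⊎_)
open import Data.Unit using (⊤)
open import Data.Empty using (⊥)
open import Relation.Binary.PropositionalEquality using (_≡_; _≢_)

-- Vertices of the direct product K_{n_1} × ... × K_{n_t}, where the list
-- ns = n_1 ∷ ... ∷ n_t : tuples (a_1 , ... , a_t) with a_i ∈ Fin n_i.
Vertex : List ℕ → Set
Vertex []       = ⊤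
Vertex (m ∷ ms) = Fin m × Vertex ms

Adj : (ns : List ℕ) → Vertex ns → Vertex ns → Set
Adj []       _       _       = ⊤
Adj (m ∷ ms) (a , u) (b , w) = a ≢ b × Adj ms u w

InClosedNbhd : (ns : List ℕ) → Vertex ns → Vertex ns → Set
InClosedNbhd ns u v = u ≡ v ⊎ Adj ns v u

PrivateNbr : (ns : List ℕ) → List (Vertex ns) → Vertex ns → Vertex ns → Set
PrivateNbr ns S v u =
  InClosedNbhd ns u v ×
  (∀ w → w ∈ S → w ≢ v → InClosedNbhd ns u w → ⊥)

Irredundant : (ns : List ℕ) → List (Vertex ns) → Set
Irredundant ns S = ∀ v → v ∈ S → ∃[ u ] PrivateNbr ns S v u

MaximalIrredundant : (ns : List ℕ) → List (Vertex ns) → Set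
MaximalIrredundant ns S =
  Irredundant ns S ×
  (∀ (S' : List (Vertex ns)) → S ⊆ S' → Irredundant ns S' → S' ⊆ S)

-- ir(G) = k : k is the minimum size of a maximal irredundant set
-- (sets are represented as duplicate-free lists)
IrNumberIs : (ns : List ℕ) → ℕ → Set
IrNumberIs ns k =
  (∃[ S ] (Unique S × MaximalIrredundant ns S × length S ≡ k)) ×
  (∀ (S : List (Vertex ns)) → Unique S → MaximalIrredundant ns S → k ≤ length S)

pred-nonZero : ∀ {n} → 2 ≤ n → NonZero (n ∸ 1)
pred-nonZero (s≤s (s≤s _)) = _

{-# OPTIONS --safe #-}
module Submission where

open import Defs
open import Algebra.Properties.CommutativeSemigroup using (interchange)
open import Data.Empty using (⊥; ⊥-elim)
open import Data.Fin using (Fin; zero; suc; _≟_)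
open import Data.Fin.Patterns using (0F; 1F; 2F)
open import Data.Fin.Properties using (any?)
open import Data.Nat using (ℕ; zero; suc; _+_; _*_; _∸_; _≤_; _<_; z≤n; s≤s; s≤s⁻¹; _≤?_; NonZero)
open import Data.Nat.Solver using (module +-*-Solver)
open import Data.Nat.DivMod using (_/_; m/n*n≤m; m/n≤m)
open import Data.Nat.Properties hiding (_≟_)
open import Data.List using (List; []; _∷_; _++_; length; filter)
open import Data.List.Membership.Propositional using (_∈_; _∉_; mapWith∈)
open import Data.List.Membership.Propositional.Properties using (∈-filter⁺; ∈-++⁺ˡ; ∈-++⁺ʳ)
open import Data.List.Membership.Setoid.Properties using (length-mapWith∈)
open import Data.List.Properties using (length-++; filter-notAll)
open import Data.List.Relation.Unary.All using (All; []; _∷_)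
import Data.List.Relation.Unary.All as All
open import Data.List.Relation.Unary.AllPairs using ([]; _∷_)
open import Data.List.Relation.Unary.Any using (here; there)
import Data.List.Relation.Unary.Any as Any
open import Data.List.Relation.Unary.Linked using (Linked; [-]; _∷_)
open import Data.List.Relation.Unary.Unique.Propositional using (Unique)
open import Data.Product using (_×_; _,_; proj₁; proj₂; ∃-syntax)
open import Data.Product.Properties using (≡-dec)
open import Data.Sum using (_⊎_; inj₁; inj₂)
open import Data.Unit using (tt)
open import Function using (_∘_)
open import Relation.Binary.Definitions using (DecidableEquality)
open import Relation.Binary.PropositionalEquality
open import Relation.Nullary using (¬_; Dec; yes; no; contradiction)
open import Relation.Nullary.Decidable using (¬?)

-- A vertex is undominated by D iff it agrees with every member of D in some coordinate and lies
-- outside D.  If at least two values are available in each of s ≥ 3 coordinates, then any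
-- b ≤ s vectors are met by a vertex avoiding any 2s + 1 − b prescribed ones.  For t ≥ 4 and
-- |D| ≤ t + ⌊(t−1)/(n₁−1)⌋ the pigeonhole principle yields a first coordinate shared by all but
-- at most t − 1 members of D; the remaining t − 1 coordinates meet the others and avoid D, so D
-- does not dominate.  The bound on ir then follows from γ ≤ 2 ir − 1.
-- For t ≤ 3 this leaves only two vertices in K_m × K_n with m, n ≥ 3, and three vertices in a
-- triple product.  There a new vertex x is exhibited that is undominated and lies outside
-- the closed neighbourhood of some private neighbour of each old vertex, contradicting maximality;
-- the construction depends on the graph the old vertices induce.

open +-*-Solver using (solve; _:+_; _:=_; con)

-- Vertices agreeing in some coordinate

Meet : (ns : List ℕ) → Vertex ns → Vertex ns → Set
Meet []       _       _       = ⊥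
Meet (m ∷ ms) (a , u) (b , w) = a ≡ b ⊎ Meet ms u w

meet-sym : ∀ ns {u v} → Meet ns u v → Meet ns v u
meet-sym (m ∷ ms) (inj₁ e) = inj₁ (sym e)
meet-sym (m ∷ ms) (inj₂ h) = inj₂ (meet-sym ms h)

adj-sym : ∀ ns {u v} → Adj ns u v → Adj ns v u
adj-sym []       _       = tt
adj-sym (m ∷ ms) (n , h) = n ∘ sym , adj-sym ms h

adj-or-meet : ∀ ns u v → Adj ns u v ⊎ Meet ns u v
adj-or-meet []       u       v       = inj₁ tt
adj-or-meet (m ∷ ms) (a , u) (b , v) with a ≟ b | adj-or-meet ms u v
... | yes e | _      = inj₂ (inj₁ e)
... | no n  | inj₁ h = inj₁ (n , h)
... | no n  | inj₂ h = inj₂ (inj₂ h)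

adj-meet-⊥ : ∀ ns {u v} → Adj ns u v → Meet ns u v → ⊥
adj-meet-⊥ (m ∷ ms) (n , h) (inj₁ e) = n e
adj-meet-⊥ (m ∷ ms) (n , h) (inj₂ k) = adj-meet-⊥ ms h k

vertex-≟ : ∀ ns → DecidableEquality (Vertex ns)
vertex-≟ []       tt tt = yes refl
vertex-≟ (m ∷ ms) = ≡-dec _≟_ (vertex-≟ ms)

-- This is exactly non-membership in the closed neighbourhood, stated positively so that witnesses
-- can be given coordinatewise.
Apart : (ns : List ℕ) → Vertex ns → Vertex ns → Set
Apart ns x y = Meet ns x y × x ≢ y

apart-sym : ∀ ns {x y} → Apart ns x y → Apart ns y x
apart-sym ns (h , n) = meet-sym ns h , n ∘ sym

apart⇒¬nbhd : ∀ ns {x y} → Apart ns x y → ¬ InClosedNbhd ns x y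
apart⇒¬nbhd ns (h , n) (inj₁ e) = n e
apart⇒¬nbhd ns (h , n) (inj₂ a) = adj-meet-⊥ ns a (meet-sym ns h)

nbhd-or-apart : ∀ ns x y → InClosedNbhd ns x y ⊎ Apart ns x y
nbhd-or-apart ns x y with vertex-≟ ns x y | adj-or-meet ns y x
... | yes e | _      = inj₁ (inj₁ e)
... | no _  | inj₁ a = inj₁ (inj₂ a)
... | no n  | inj₂ h = inj₂ (meet-sym ns h , n)

¬nbhd⇒apart : ∀ ns {x y} → ¬ InClosedNbhd ns x y → Apart ns x y
¬nbhd⇒apart ns {x} {y} n with nbhd-or-apart ns x y
... | inj₁ h = contradiction h n
... | inj₂ h = h

-- Lower bounds for maximal irredundant sets

Undominated : (ns : List ℕ) → Vertex ns → List (Vertex ns) → Set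
Undominated ns x D = ∀ {d} → d ∈ D → Apart ns x d

-- With `x` as its own private neighbour and every old vertex keeping one outside `N[x]`, the list
-- `x ∷ S` is irredundant. Maximality then puts `x` into `S`, so `x` would be apart from itself.
no-extension : ∀ ns {S x} → MaximalIrredundant ns S → Undominated ns x S →
  (∀ v → v ∈ S → ∃[ p ] PrivateNbr ns S v p × Apart ns x p) → ⊥
no-extension ns {S} {x} (irr , max) x-free priv =
  proj₂ (x-free (max (x ∷ S) there irr′ (here refl))) refl
  where
  irr′ : Irredundant ns (x ∷ S)
  irr′ v (here refl) = x , inj₁ refl , λ where
    w (here e)  w≢x _ → w≢x e
    w (there h) w≢x b → apart⇒¬nbhd ns (x-free h) b
  irr′ v (there v∈S) with priv v v∈S
  ... | p , (nb , pr) , ap = p , nb , λ where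
    w (here refl) w≢v b → apart⇒¬nbhd ns (apart-sym ns ap) b
    w (there h)   w≢v b → pr w h w≢v b

∈-mapWith∈ : ∀ {A B : Set} {xs : List A} (f : ∀ {x} → x ∈ xs → B) {x} (h : x ∈ xs) →
  f h ∈ mapWith∈ xs f
∈-mapWith∈ f (here refl) = here refl
∈-mapWith∈ f (there h)   = there (∈-mapWith∈ (f ∘ there) h)

-- This is γ ≤ 2 ir − 1.  The union T of S and a choice of private neighbours dominates.  If no
-- T ∖ {v} dominates, then T is irredundant, so T ⊆ S by maximality and S itself dominates.
maximalIrredundant-bound : ∀ ns N →
  (∀ D → length D ≤ N → ∃[ x ] Undominated ns x D) →
  ∀ S → MaximalIrredundant ns S → N + 2 ≤ 2 * length S
maximalIrredundant-bound ns N undom S M@(irr , max) with N + 2 ≤? 2 * length S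
... | yes h = h
... | no ¬h = ⊥-elim (T-dominates (proj₁ y) y-free-T)
  where
  private-of : ∀ {v} → v ∈ S → Vertex ns
  private-of h = proj₁ (irr _ h)

  T : List (Vertex ns)
  T = S ++ mapWith∈ S private-of

  T-dominates : ∀ x → Undominated ns x T → ⊥
  T-dominates x x-free = no-extension ns M (λ h → x-free (∈-++⁺ˡ h)) (λ v h →
    private-of h , proj₂ (irr v h) , x-free (∈-++⁺ʳ S (∈-mapWith∈ private-of h)))

  k = length S

  k+k≤1+N : k + k ≤ suc N
  k+k≤1+N = s≤s⁻¹ (subst₂ _≤_ (cong (λ z → suc (k + z)) (+-identityʳ k)) (+-comm N 2) (≰⇒> ¬h))

  length-T : length T ≡ k + k
  length-T = trans (length-++ S) (cong (k +_) (length-mapWith∈ (setoid (Vertex ns)) S))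

  T-irredundant : Irredundant ns T
  -- Removing all copies of `v` leaves at most `N` entries. A vertex undominated by these either
  -- lies in `N[v]`, hence is private to `v`, or is undominated by all of `T`.
  T-irredundant v v∈T with undom (filter (λ w → ¬? (vertex-≟ ns w v)) T)
      (s≤s⁻¹ (≤-trans (filter-notAll _ T (Any.map (λ e n → n (sym e)) v∈T))
                      (≤-trans (≤-reflexive length-T) k+k≤1+N)))
  ... | x , x-free with nbhd-or-apart ns x v
  ... | inj₁ nb = x , nb , λ w w∈T w≢v →
    apart⇒¬nbhd ns (x-free (∈-filter⁺ (λ w → ¬? (vertex-≟ ns w v)) w∈T w≢v))
  ... | inj₂ ap = ⊥-elim (T-dominates x free)
    where
    free : Undominated ns x T
    free {w} w∈T with vertex-≟ ns w v
    ... | yes refl = ap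
    ... | no n     = x-free (∈-filter⁺ (λ w → ¬? (vertex-≟ ns w v)) w∈T n)

  k≤N : ∀ j → j + j ≤ suc N → j ≤ N
  k≤N zero    _ = z≤n
  k≤N (suc j) h = ≤-trans (m≤n+m (suc j) j) (s≤s⁻¹ h)

  y : ∃[ x ] Undominated ns x S
  y = undom S (k≤N k k+k≤1+N)

  y-free-T : Undominated ns (proj₁ y) T
  y-free-T h = proj₂ y (max T ∈-++⁺ˡ T-irredundant h)

-- Slicing a list of vertices by the first coordinate

module _ {m : ℕ} {V : Set} where

  -- Once the first coordinate is fixed to `c`, `rest c` holds the tails still to be met and
  -- `fibre c` the tails with which a coincidence is still possible.
  rest : Fin m → List (Fin m × V) → List V
  rest c []            = []
  rest c ((a , v) ∷ D) with c ≟ a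
  ... | yes _ = rest c D
  ... | no _  = v ∷ rest c D

  fibre : Fin m → List (Fin m × V) → List V
  fibre c []            = []
  fibre c ((a , v) ∷ D) with c ≟ a
  ... | yes _ = v ∷ fibre c D
  ... | no _  = fibre c D

  rest+fibre : ∀ c D → length (rest c D) + length (fibre c D) ≡ length D
  rest+fibre c []            = refl
  rest+fibre c ((a , v) ∷ D) with c ≟ a
  ... | yes _ = trans (+-suc _ _) (cong suc (rest+fibre c D))
  ... | no _  = cong suc (rest+fibre c D)

  rest-≤ : ∀ c D → length (rest c D) ≤ length D
  rest-≤ c D = subst (length (rest c D) ≤_) (rest+fibre c D) (m≤m+n _ _)

  fibre-≤ : ∀ c D → length (fibre c D) ≤ length D
  fibre-≤ c D = subst (length (fibre c D) ≤_) (rest+fibre c D) (m≤n+m _ _)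

  rest-hit : ∀ c {v} D → rest c ((c , v) ∷ D) ≡ rest c D
  rest-hit c D with c ≟ c
  ... | yes _ = refl
  ... | no n  = contradiction refl n

  rest-step : ∀ c d D → length (rest c (d ∷ D)) ≤ suc (length (rest c D))
  rest-step c (a , v) D with c ≟ a
  ... | yes _ = n≤1+n _
  ... | no _  = ≤-refl

  rest-< : ∀ {c v} D → (c , v) ∈ D → length (rest c D) < length D
  rest-< {c} (d ∷ D) (here refl) = s≤s (≤-trans (≤-reflexive (cong length (rest-hit c D))) (rest-≤ c D))
  rest-< {c} (d ∷ D) (there h)   = s≤s (≤-trans (rest-step c d D) (rest-< D h))

  fibre-pair : ∀ {c c′} → c ≢ c′ → ∀ D → length (fibre c D) + length (fibre c′ D) ≤ length D
  fibre-pair         n []            = z≤n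
  fibre-pair {c} {c′} n ((a , v) ∷ D) with c ≟ a | c′ ≟ a
  ... | yes e | yes e′ = contradiction (trans e (sym e′)) n
  ... | yes _ | no _   = s≤s (fibre-pair n D)
  ... | no _  | yes _  = ≤-trans (≤-reflexive (+-suc _ _)) (s≤s (fibre-pair n D))
  ... | no _  | no _   = m≤n⇒m≤1+n (fibre-pair n D)

  fibre-triple : ∀ {c c′ c″} → c ≢ c′ → c ≢ c″ → c′ ≢ c″ → ∀ D →
    length (fibre c D) + (length (fibre c′ D) + length (fibre c″ D)) ≤ length D
  fibre-triple n n′ n″ []            = z≤n
  fibre-triple {c} {c′} {c″} n n′ n″ ((a , v) ∷ D) with c ≟ a | c′ ≟ a | c″ ≟ a
  ... | yes e | yes e′ | _      = contradiction (trans e (sym e′)) n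
  ... | yes e | _      | yes e″ = contradiction (trans e (sym e″)) n′
  ... | _     | yes e′ | yes e″ = contradiction (trans e′ (sym e″)) n″
  ... | yes _ | no _   | no _   = s≤s (fibre-triple n n′ n″ D)
  ... | no _  | yes _  | no _   = ≤-trans (≤-reflexive (+-suc _ _)) (s≤s (fibre-triple n n′ n″ D))
  ... | no _  | no _   | yes _  =
    ≤-trans (≤-reflexive (trans (cong (length (fibre c D) +_) (+-suc _ _)) (+-suc _ _)))
            (s≤s (fibre-triple n n′ n″ D))
  ... | no _  | no _   | no _   = m≤n⇒m≤1+n (fibre-triple n n′ n″ D)

  ∈-rest : ∀ {c a v} {D : List (Fin m × V)} → c ≢ a → (a , v) ∈ D → v ∈ rest c D
  ∈-rest {c} {D = (b , w) ∷ D} n (here refl) with c ≟ b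
  ... | yes e = contradiction e n
  ... | no _  = here refl
  ∈-rest {c} {D = (b , w) ∷ D} n (there h) with c ≟ b
  ... | yes _ = ∈-rest n h
  ... | no _  = there (∈-rest n h)

  ∈-fibre : ∀ {c v} {D : List (Fin m × V)} → (c , v) ∈ D → v ∈ fibre c D
  ∈-fibre {c} {D = (b , w) ∷ D} (here refl) with c ≟ c
  ... | yes _ = here refl
  ... | no n  = contradiction refl n
  ∈-fibre {c} {D = (b , w) ∷ D} (there h) with c ≟ b
  ... | yes _ = there (∈-fibre h)
  ... | no _  = ∈-fibre h

  uniform-or-other : ∀ c D → rest c D ≡ [] ⊎ (∃[ a ] ∃[ v ] c ≢ a × (a , v) ∈ D)
  uniform-or-other c []            = inj₁ refl
  uniform-or-other c ((a , v) ∷ D) with c ≟ a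
  ... | no n  = inj₂ (a , v , n , here refl)
  ... | yes _ with uniform-or-other c D
  ...   | inj₁ e                = inj₁ e
  ...   | inj₂ (b , w , n , h) = inj₂ (b , w , n , there h)

other : ∀ {m} → 2 ≤ m → (a : Fin m) → ∃[ b ] a ≢ b
other (s≤s (s≤s _)) zero    = suc zero , λ ()
other (s≤s (s≤s _)) (suc _) = zero , λ ()

-- Two summands above `k` already give `2k + 2`. This is why a choice between two slices can raise a
-- budget `k` to `2k + 1`.
halve : ∀ {a b} k → a + b ≤ suc (k + k) → a ≤ k ⊎ b ≤ k
halve {a} {b} k h with a ≤? k
... | yes p = inj₁ p
... | no n  = inj₂ (+-cancelˡ-≤ (suc k) b k (≤-trans (+-monoˡ-≤ b (≰⇒> n)) h))

third : ∀ {a b c} → a + (b + c) ≤ 4 → a ≤ 1 ⊎ b ≤ 1 ⊎ c ≤ 1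
third {a} {b} {c} h with a ≤? 1 | halve {b} {c} 1
... | yes p | _ = inj₁ p
... | no n  | f = inj₂ (f (≤-trans (+-cancelˡ-≤ 2 (b + c) 2 (≤-trans (+-monoˡ-≤ (b + c) (≰⇒> n)) h)) (n≤1+n 2)))

-- Vertices meeting all of B outside E

Avoids : (ns : List ℕ) → List (Vertex ns) → List (Vertex ns) → Set
Avoids ns B E = ∃[ x ] (∀ {d} → d ∈ B → Meet ns x d) × x ∉ E

-- Both lists are charged to one budget because slicing at `c` keeps from `B` what differs from `c`
-- and from `E` what equals it; for `B = E` the joint length falls to that of a single copy.
Avoidable : (ns : List ℕ) → ℕ → ℕ → Set
Avoidable ns s k = ∀ B E → length B ≤ s → length B + length E ≤ k → Avoids ns B E

lift : ∀ {m ms} (c : Fin m) {B E} → Avoids ms (rest c B) (fibre c E) → Avoids (m ∷ ms) B E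
lift {m} {ms} c {B} {E} (x , meets , x∉) = (c , x) , meets′ , λ h → x∉ (∈-fibre h)
  where
  meets′ : ∀ {d} → d ∈ B → Meet (m ∷ ms) (c , x) d
  meets′ {a , v} h with c ≟ a
  ... | yes e = inj₁ e
  ... | no n  = inj₂ (meets (∈-rest n h))

-- Fibres of `E` over distinct values are disjoint, so the joint lengths of the two slices add up to
-- at most `2k + 1`, and one slice fits the budget `k`.
avoid-pair : ∀ {m ms s k B E} {c c′ : Fin m} {r r′} → Avoidable ms s k → c ≢ c′ →
  length (rest c B) ≤ r → length (rest c′ B) ≤ r′ → r ≤ s → r′ ≤ s →
  r + r′ + length E ≤ suc (k + k) → Avoids (m ∷ ms) B E
avoid-pair {k = k} {B} {E} {c} {c′} ih n p p′ q q′ h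
  with halve {length (rest c B) + length (fibre c E)} {length (rest c′ B) + length (fibre c′ E)} k
    (≤-trans (≤-reflexive (interchange +-commutativeSemigroup
                             (length (rest c B)) (length (fibre c E)) (length (rest c′ B)) _))
    (≤-trans (+-mono-≤ (+-mono-≤ p p′) (fibre-pair n E)) h))
... | inj₁ b = lift c (ih _ _ (≤-trans p q) b)
... | inj₂ b = lift c′ (ih _ _ (≤-trans p′ q′) b)

avoid-uniform : ∀ {m ms s k B E} {c : Fin m} → Avoidable ms s k → rest c B ≡ [] →
  length (fibre c E) ≤ k → Avoids (m ∷ ms) B E
avoid-uniform {B = B} {E} {c} ih e h =
  lift c (ih _ _ (≤-trans (≤-reflexive (cong length e)) z≤n)
                 (≤-trans (≤-reflexive (cong (λ z → length z + length (fibre c E)) e)) h))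

two : ∀ {m} → 2 ≤ m → ∃[ a ] ∃[ b ] _≢_ {A = Fin m} a b
two (s≤s (s≤s _)) = zero , suc zero , λ ()

avoid₀ : Avoidable [] 0 0
avoid₀ [] [] _ _ = tt , (λ ()) , (λ ())

avoid₁ : ∀ {m} → 2 ≤ m → Avoidable (m ∷ []) 1 1
avoid₁ 2≤m [] E _ h =
  let _ , _ , n = two 2≤m in avoid-pair avoid₀ n z≤n z≤n z≤n z≤n h
avoid₁ 2≤m (d ∷ []) E _ h =
  avoid-uniform {c = proj₁ d} avoid₀ (rest-hit (proj₁ d) []) (≤-trans (fibre-≤ _ E) (s≤s⁻¹ h))
avoid₁ 2≤m (_ ∷ _ ∷ _) E (s≤s ()) h

-- The first entry of `d` leaves nothing to meet and any other value leaves at most `d`, so the two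
-- slices cost `0 + 1` beyond `E`.
avoid-one : ∀ {m ms s k E} → 2 ≤ m → Avoidable ms (suc s) k → (d : Vertex (m ∷ ms)) →
  1 + length E ≤ suc (k + k) → Avoids (m ∷ ms) (d ∷ []) E
avoid-one 2≤m ih d h =
  avoid-pair ih (proj₂ (other 2≤m (proj₁ d))) (≤-reflexive (cong length (rest-hit (proj₁ d) [])))
             (rest-≤ (proj₁ (other 2≤m (proj₁ d))) (d ∷ [])) z≤n (s≤s z≤n) h

avoid₂ : ∀ {m₁ m₂} → 2 ≤ m₁ → 2 ≤ m₂ → Avoidable (m₁ ∷ m₂ ∷ []) 2 3
avoid₂ p₁ p₂ [] E _ h = let _ , _ , n = two p₁ in avoid-pair (avoid₁ p₂) n z≤n z≤n z≤n z≤n h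
avoid₂ p₁ p₂ (d ∷ []) E _ h = avoid-one p₁ (avoid₁ p₂) d h
avoid₂ p₁ p₂ B@((a , _) ∷ (a′ , _) ∷ []) E _ h with a ≟ a′
... | yes refl = avoid-uniform {c = a} (avoid₁ p₂) (trans (rest-hit a _) (rest-hit a []))
                   (≤-trans (fibre-≤ _ E) (s≤s⁻¹ (s≤s⁻¹ h)))
... | no n = avoid-pair (avoid₁ p₂) n (s≤s⁻¹ (rest-< B (here refl)))
               (s≤s⁻¹ (rest-< B (there (here refl)))) ≤-refl ≤-refl h
avoid₂ p₁ p₂ (_ ∷ _ ∷ _ ∷ _) E (s≤s (s≤s ())) h

length-0-∉ : ∀ {A : Set} {x : A} {xs} → length xs ≤ 0 → x ∉ xs
length-0-∉ {xs = []} _ ()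

-- Three vectors with the same first entry, the case in which slicing alone loses one vertex.
avoid₃-uniform : ∀ {m₁ m₂ m₃} → 2 ≤ m₁ → 2 ≤ m₂ → 2 ≤ m₃ →
  (a : Fin m₁) (d d′ d″ : Vertex (m₂ ∷ m₃ ∷ [])) (E : List (Vertex (m₁ ∷ m₂ ∷ m₃ ∷ []))) →
  length E ≤ 4 → Avoids (m₁ ∷ m₂ ∷ m₃ ∷ []) ((a , d) ∷ (a , d′) ∷ (a , d″) ∷ []) E
avoid₃-uniform {m₁} {m₂} {m₃} p₁ p₂ p₃ a (y₁ , z₁ , _) (y₂ , z₂ , _) (y₃ , z₃ , _) E h
  with length (fibre a E) ≤? 3
... | yes le = avoid-uniform (avoid₂ p₂ p₃)
                 (trans (rest-hit a _) (trans (rest-hit a _) (rest-hit a []))) le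
... | no gt = result
  where
  -- `E` has at most four vectors and at least four lie over `a`, so any other first value avoids
  -- `E` outright.
  a′ = proj₁ (other p₁ a)

  empty : length (fibre a′ E) ≤ 0
  empty = +-cancelˡ-≤ 4 _ 0 (≤-trans (+-monoˡ-≤ _ (≰⇒> gt))
            (≤-trans (fibre-pair (proj₂ (other p₁ a)) E) h))

  B : List (Vertex (m₁ ∷ m₂ ∷ m₃ ∷ []))
  B = (a , y₁ , z₁ , tt) ∷ (a , y₂ , z₂ , tt) ∷ (a , y₃ , z₃ , tt) ∷ []

  -- The value `a` meets all of `B`, so only `E` remains to be avoided; with second entry `y` at
  -- most one tail is forbidden.
  sliced : ∀ y → length (fibre y (fibre a E)) ≤ 1 → Avoids (m₁ ∷ m₂ ∷ m₃ ∷ []) B E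
  sliced y le = lift a (subst (λ R → Avoids (m₂ ∷ m₃ ∷ []) R (fibre a E))
    (sym (trans (rest-hit a _) (trans (rest-hit a _) (rest-hit a []))))
    (avoid-uniform {c = y} (avoid₁ p₃) refl le))

  outside : ∀ {x} → (a′ , x) ∉ E
  outside h = length-0-∉ empty (∈-fibre h)

  result : Avoids (m₁ ∷ m₂ ∷ m₃ ∷ []) B E
  -- Two equal second entries are met together, leaving the third coordinate for the remaining
  -- vector. If all three differ, the four vectors of `E` cannot occupy each of these values twice.
  result with y₁ ≟ y₂ | y₁ ≟ y₃ | y₂ ≟ y₃
  ... | yes e | _ | _ = (a′ , y₁ , z₃ , tt) , (λ where
    (here refl)                 → inj₂ (inj₁ refl)
    (there (here refl))         → inj₂ (inj₁ e)
    (there (there (here refl))) → inj₂ (inj₂ (inj₁ refl))) , outside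
  ... | no _ | yes e | _ = (a′ , y₁ , z₂ , tt) , (λ where
    (here refl)                 → inj₂ (inj₁ refl)
    (there (here refl))         → inj₂ (inj₂ (inj₁ refl))
    (there (there (here refl))) → inj₂ (inj₁ e)) , outside
  ... | no _ | no _ | yes e = (a′ , y₂ , z₁ , tt) , (λ where
    (here refl)                 → inj₂ (inj₂ (inj₁ refl))
    (there (here refl))         → inj₂ (inj₁ refl)
    (there (there (here refl))) → inj₂ (inj₁ e)) , outside
  ... | no n | no n′ | no n″
    with third (≤-trans (fibre-triple n n′ n″ (fibre a E)) (≤-trans (fibre-≤ a E) h))
  ...   | inj₁ le        = sliced y₁ le
  ...   | inj₂ (inj₁ le) = sliced y₂ le
  ...   | inj₂ (inj₂ le) = sliced y₃ le

-- The budget `7` is `2 · 3 + 1` over that of `avoid₂`, and also `2s + 1` at `s = 3`, where the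
-- induction of `avoid` starts.
avoid₃ : ∀ {m₁ m₂ m₃} → 2 ≤ m₁ → 2 ≤ m₂ → 2 ≤ m₃ → Avoidable (m₁ ∷ m₂ ∷ m₃ ∷ []) 3 7
avoid₃ p₁ p₂ p₃ [] E _ h =
  let _ , _ , n = two p₁ in avoid-pair (avoid₂ p₂ p₃) n z≤n z≤n z≤n z≤n h
avoid₃ p₁ p₂ p₃ (d ∷ []) E _ h = avoid-one p₁ (avoid₂ p₂ p₃) d h
avoid₃ p₁ p₂ p₃ B@((a , _) ∷ (a′ , _) ∷ []) E _ h with a ≟ a′
... | yes refl = avoid-pair (avoid₂ p₂ p₃) (proj₂ (other p₁ a))
                   (≤-reflexive (cong length (trans (rest-hit a _) (rest-hit a []))))
                   (rest-≤ (proj₁ (other p₁ a)) B) z≤n ≤-refl h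
... | no n = avoid-pair (avoid₂ p₂ p₃) n (s≤s⁻¹ (rest-< B (here refl)))
               (s≤s⁻¹ (rest-< B (there (here refl)))) (n≤1+n 1) (n≤1+n 1) h
avoid₃ p₁ p₂ p₃ B@((a , d) ∷ (a′ , d′) ∷ (a″ , d″) ∷ []) E _ h with a ≟ a′ | a ≟ a″ | a′ ≟ a″
... | yes refl | yes refl | _ = avoid₃-uniform p₁ p₂ p₃ a d d′ d″ E (s≤s⁻¹ (s≤s⁻¹ (s≤s⁻¹ h)))
... | yes refl | no n | _ = avoid-pair (avoid₂ p₂ p₃) n
        (≤-trans (≤-reflexive (cong length (trans (rest-hit a _) (rest-hit a _)))) (rest-≤ a _))
        (s≤s⁻¹ (rest-< B (there (there (here refl))))) (n≤1+n 1) ≤-refl h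
... | no n | yes refl | _ = avoid-pair (avoid₂ p₂ p₃) n
        (≤-trans (≤-reflexive (cong length (rest-hit a _)))
                 (s≤s⁻¹ (rest-< {c = a} ((a′ , d′) ∷ (a , d″) ∷ []) (there (here refl)))))
        (s≤s⁻¹ (rest-< B (there (here refl)))) (n≤1+n 1) ≤-refl h
... | no n | no _ | yes refl = avoid-pair (avoid₂ p₂ p₃) (n ∘ sym)
        (≤-trans (rest-step a′ (a , d) _)
                 (s≤s (≤-reflexive (cong length (trans (rest-hit a′ _) (rest-hit a′ []))))))
        (s≤s⁻¹ (rest-< B (here refl))) (n≤1+n 1) ≤-refl h
-- Two slices may cost `2 + 2 + 4 = 8`, one too many for `avoid-pair`. With three values available,
-- some fibre of `E` has at most one vector, and `2 + 1` fits the budget `3`.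
... | no n | no n′ | no n″
  with third (≤-trans (fibre-triple n n′ n″ E) (s≤s⁻¹ (s≤s⁻¹ (s≤s⁻¹ h))))
...   | inj₁ le = lift a (avoid₂ p₂ p₃ _ _ q (+-mono-≤ q le))
  where q = s≤s⁻¹ (rest-< B (here refl))
...   | inj₂ (inj₁ le) = lift a′ (avoid₂ p₂ p₃ _ _ q (+-mono-≤ q le))
  where q = s≤s⁻¹ (rest-< B (there (here refl)))
...   | inj₂ (inj₂ le) = lift a″ (avoid₂ p₂ p₃ _ _ q (+-mono-≤ q le))
  where q = s≤s⁻¹ (rest-< B (there (there (here refl))))
avoid₃ p₁ p₂ p₃ (_ ∷ _ ∷ _ ∷ _ ∷ _) E (s≤s (s≤s (s≤s ()))) h

-- If `B` has at most `s` vectors, any two values serve. If it has `s + 1` with two different first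
-- entries, each of these leaves at most `s` to meet. If all first entries coincide, only `E`
-- matters, and `1 ≤ s` gives `|E| ≤ s + 2 ≤ 2s + 1`.
avoid-step : ∀ {m ms s} → 2 ≤ m → 1 ≤ s → Avoidable ms s (suc (s + s)) →
  Avoidable (m ∷ ms) (suc s) (suc (suc s + suc s))
avoid-step {m} {ms} {s} 2≤m 1≤s ih B E hB h = result B hB h (length B ≤? s)
  where
  -- The allowance of `avoid-pair` is matched exactly: `2s + (2s + 3) = 2 (2s + 1) + 1`.
  budget : ∀ b → b + length E ≤ suc (suc s + suc s) →
    s + s + length E ≤ suc (suc (s + s) + suc (s + s))
  budget b h = ≤-trans (+-monoʳ-≤ (s + s) (≤-trans (m≤n+m _ b) h)) (≤-reflexive (solve 1
    (λ x → x :+ x :+ (con 1 :+ (con 1 :+ x :+ (con 1 :+ x))) :=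
           con 1 :+ (con 1 :+ (x :+ x) :+ (con 1 :+ (x :+ x)))) refl s))

  result : ∀ B → length B ≤ suc s → length B + length E ≤ suc (suc s + suc s) →
    Dec (length B ≤ s) → Avoids (m ∷ ms) B E
  result B hB h (yes b≤s) = let c , c′ , n = two 2≤m in
    avoid-pair ih n (≤-trans (rest-≤ c B) b≤s) (≤-trans (rest-≤ c′ B) b≤s) ≤-refl ≤-refl
               (budget (length B) h)
  result [] hB h (no b>s) = contradiction z≤n b>s
  result B@((c , v) ∷ _) hB h (no b>s) with uniform-or-other c B
  ... | inj₁ e = avoid-uniform ih e
    (≤-trans (fibre-≤ c E)
    (≤-trans (+-cancelˡ-≤ (suc s) _ _ (≤-trans (+-monoˡ-≤ (length E) (≰⇒> b>s))
                                      (≤-trans h (≤-reflexive (sym (+-suc (suc s) (suc s)))))))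
             (s≤s (+-monoˡ-≤ s 1≤s))))
  ... | inj₂ (c′ , _ , n , mem) =
    avoid-pair ih n (s≤s⁻¹ (≤-trans (rest-< B (here refl)) hB)) (s≤s⁻¹ (≤-trans (rest-< B mem) hB))
               ≤-refl ≤-refl (budget (length B) h)

avoid : ∀ {ns} → All (2 ≤_) ns → 3 ≤ length ns →
  Avoidable ns (length ns) (suc (length ns + length ns))
avoid (p₁ ∷ p₂ ∷ p₃ ∷ [])         _ = avoid₃ p₁ p₂ p₃
avoid (p ∷ ps@(_ ∷ _ ∷ _ ∷ _)) _ = avoid-step p (s≤s z≤n) (avoid ps (s≤s (s≤s (s≤s z≤n))))
avoid []            ()
avoid (_ ∷ [])      (s≤s ())
avoid (_ ∷ _ ∷ []) (s≤s (s≤s ()))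

-- Undominated vertices for small sets

avoids⇒undominated : ∀ {ns D} → Avoids ns D D → ∃[ x ] Undominated ns x D
avoids⇒undominated (x , meets , x∉D) = x , λ h → meets h , λ { refl → x∉D h }

undominated-small : ∀ {ns s k D} → Avoidable ns s k → length D ≤ s → length D + length D ≤ k →
  ∃[ x ] Undominated ns x D
undominated-small a p q = avoids⇒undominated (a _ _ p q)

module _ {V : Set} where

  -- Discarding the fibre over `zero` and renumbering the other values lets the pigeonhole count go
  -- by induction on the number of values.
  shift : ∀ {m} → List (Fin (suc m) × V) → List (Fin m × V)
  shift []                = []
  shift ((zero , _) ∷ D)  = shift D
  shift ((suc a , v) ∷ D) = (a , v) ∷ shift D

  shift-length : ∀ {m} (D : List (Fin (suc m) × V)) →
    length D ≡ length (fibre zero D) + length (shift D)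
  shift-length []                = refl
  shift-length ((zero , _) ∷ D)  = cong suc (shift-length D)
  shift-length ((suc _ , _) ∷ D) = trans (cong suc (shift-length D)) (sym (+-suc _ _))

  shift-fibre : ∀ {m} (a : Fin m) D → fibre a (shift D) ≡ fibre (suc a) D
  shift-fibre a []                = refl
  shift-fibre a ((zero , _) ∷ D)  = shift-fibre a D
  shift-fibre a ((suc b , v) ∷ D) with a ≟ b
  ... | yes _ = cong (v ∷_) (shift-fibre a D)
  ... | no _  = shift-fibre a D

  fibres-bound : ∀ m r (D : List (Fin m × V)) → (∀ a → length (fibre a D) ≤ r) → length D ≤ m * r
  fibres-bound zero    r []             h = z≤n
  fibres-bound zero    r ((() , _) ∷ _) h
  fibres-bound (suc m) r D              h = ≤-trans (≤-reflexive (shift-length D))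
    (+-mono-≤ (h zero) (fibres-bound m r (shift D)
      (λ a → ≤-trans (≤-reflexive (cong length (shift-fibre a D))) (h (suc a)))))

  -- If every rest exceeded `s`, each fibre would have at most `r = |D| - (s + 1)` entries. Then
  -- `r + (s + 1) ≤ (m + 1) r`, so `s + 1 ≤ m r ≤ m ⌊s / m⌋ ≤ s`.
  popular-value : ∀ {m} (s : ℕ) .{{_ : NonZero m}} (D : List (Fin (suc m) × V)) →
    length D ≤ suc s + s / m → ∃[ a ] length (rest a D) ≤ s
  popular-value {m} s D h with any? (λ a → length (rest a D) ≤? s)
  ... | yes p = p
  ... | no ¬p = ⊥-elim (<-irrefl refl (begin
    suc s         ≤⟨ +-cancelˡ-≤ r (suc s) (m * r) r+s<r+m*r ⟩
    m * r         ≤⟨ *-monoʳ-≤ m r≤q ⟩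
    m * (s / m)   ≡⟨ *-comm m (s / m) ⟩
    s / m * m     ≤⟨ m/n*n≤m s m ⟩
    s             ∎))
    where
    open ≤-Reasoning
    r = length D ∸ suc s

    rest> : ∀ a → suc s ≤ length (rest a D)
    rest> a = ≰⇒> (λ le → ¬p (a , le))

    r≤q : r ≤ s / m
    r≤q = ≤-trans (∸-monoˡ-≤ (suc s) h) (≤-reflexive (m+n∸m≡n (suc s) (s / m)))

    fibre≤r : ∀ a → length (fibre a D) ≤ r
    fibre≤r a = m+n≤o⇒n≤o∸m (suc s) (≤-trans (+-monoˡ-≤ _ (rest> a)) (≤-reflexive (rest+fibre a D)))
      where
      m+n≤o⇒n≤o∸m : ∀ a {b c} → a + b ≤ c → b ≤ c ∸ a
      m+n≤o⇒n≤o∸m a {b} le = ≤-trans (≤-reflexive (sym (m+n∸m≡n a b))) (∸-monoˡ-≤ a le)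

    r+s<r+m*r : r + suc s ≤ r + m * r
    r+s<r+m*r = ≤-trans (≤-reflexive (m∸n+n≡m (≤-trans (rest> zero) (rest-≤ zero D))))
                        (fibres-bound (suc m) r D fibre≤r)

undominated-large : ∀ {m ms} .{{_ : NonZero m}} → All (2 ≤_) ms → 3 ≤ length ms → ∀ D →
  length D ≤ suc (length ms) + length ms / m → ∃[ x ] Undominated (suc m ∷ ms) x D
undominated-large {m} {ms} all≥2 3≤s D h with popular-value (length ms) D h
-- Members starting with `a` are met there and need only be avoided. With `s = length ms`, the joint
-- length is `|D| ≤ s + 1 + ⌊s / m⌋ ≤ 2s + 1`.
... | a , rest≤s = avoids⇒undominated (lift a (avoid all≥2 3≤s (rest a D) (fibre a D) rest≤s
  (≤-trans (≤-reflexive (rest+fibre a D))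
  (≤-trans h (s≤s (+-monoʳ-≤ (length ms) (m/n≤m (length ms) m)))))))

-- Maximal irredundant sets of size two in K_m × K_n

third-value : ∀ {m} → 3 ≤ m → (a b : Fin m) → ∃[ c ] a ≢ c × b ≢ c
third-value (s≤s (s≤s (s≤s _))) zero          zero          = suc zero , (λ ()) , (λ ())
third-value (s≤s (s≤s (s≤s _))) zero          (suc zero)    = suc (suc zero) , (λ ()) , (λ ())
third-value (s≤s (s≤s (s≤s _))) zero          (suc (suc _)) = suc zero , (λ ()) , (λ ())
third-value (s≤s (s≤s (s≤s _))) (suc _)       (suc _)       = zero , (λ ()) , (λ ())
third-value (s≤s (s≤s (s≤s _))) (suc zero)    zero          = suc (suc zero) , (λ ()) , (λ ())
third-value (s≤s (s≤s (s≤s _))) (suc (suc _)) zero          = suc zero , (λ ()) , (λ ())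

≢₁ : ∀ {A B : Set} {a a′ : A} {b b′ : B} → a ≢ a′ → (a , b) ≢ (a′ , b′)
≢₁ n refl = n refl

≢₂ : ∀ {A B : Set} {a a′ : A} {b b′ : B} → b ≢ b′ → (a , b) ≢ (a′ , b′)
≢₂ n refl = n refl

Extension₂ : (ns : List ℕ) → Vertex ns → Vertex ns → Set
Extension₂ ns u v = ∃[ x ] Apart ns x u × Apart ns x v ×
  (∃[ p ] InClosedNbhd ns p u × Apart ns p v × Meet ns x p) ×
  (∃[ p ] InClosedNbhd ns p v × Apart ns p u × Meet ns x p)

-- For adjacent `u` and `v`, `x` is a mixed corner and third values supply the private neighbours.
-- If they share a coordinate, each is its own private neighbour and `x` is a third vertex on their
-- common line.
extension₂ : ∀ {m n} → 3 ≤ m → 3 ≤ n → (u v : Vertex (m ∷ n ∷ [])) → u ≢ v →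
  Extension₂ (m ∷ n ∷ []) u v
extension₂ {m} {n} p q u@(a₀ , b₀ , _) v@(a₁ , b₁ , _) u≢v
  with adj-or-meet (m ∷ n ∷ []) u v | third-value p a₀ a₁ | third-value q b₀ b₁
... | inj₁ (a≢ , b≢ , _) | a₂ , a₀≢a₂ , a₁≢a₂ | b₂ , b₀≢b₂ , b₁≢b₂ =
  (a₀ , b₁ , tt) ,
  (inj₁ refl , ≢₂ (≢₁ (b≢ ∘ sym))) , (inj₂ (inj₁ refl) , ≢₁ a≢) ,
  ((a₂ , b₁ , tt) , inj₂ (a₀≢a₂ , b≢ , tt) , (inj₂ (inj₁ refl) , ≢₁ (a₁≢a₂ ∘ sym)) , inj₂ (inj₁ refl)) ,
  ((a₀ , b₂ , tt) , inj₂ (a≢ ∘ sym , b₁≢b₂ , tt) , (inj₁ refl , ≢₂ (≢₁ (b₀≢b₂ ∘ sym))) , inj₁ refl)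
... | inj₂ h@(inj₁ refl) | _ | b₂ , b₀≢b₂ , b₁≢b₂ =
  (a₀ , b₂ , tt) ,
  (inj₁ refl , ≢₂ (≢₁ (b₀≢b₂ ∘ sym))) , (inj₁ refl , ≢₂ (≢₁ (b₁≢b₂ ∘ sym))) ,
  (u , inj₁ refl , (h , u≢v) , inj₁ refl) ,
  (v , inj₁ refl , (inj₁ refl , u≢v ∘ sym) , inj₁ refl)
... | inj₂ h@(inj₂ (inj₁ refl)) | a₂ , a₀≢a₂ , a₁≢a₂ | _ =
  (a₂ , b₀ , tt) ,
  (inj₂ (inj₁ refl) , ≢₁ (a₀≢a₂ ∘ sym)) , (inj₂ (inj₁ refl) , ≢₁ (a₁≢a₂ ∘ sym)) ,
  (u , inj₁ refl , (h , u≢v) , inj₂ (inj₁ refl)) ,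
  (v , inj₁ refl , (inj₂ (inj₁ refl) , u≢v ∘ sym) , inj₂ (inj₁ refl))

-- If `x` were `p`, it would lie in `N[v]`. Hence extensions only record that `x` meets the private
-- neighbours.
apart-from-private : ∀ ns {x p v} → Apart ns x v → InClosedNbhd ns p v → Meet ns x p → Apart ns x p
apart-from-private ns ap nb h = h , λ { refl → apart⇒¬nbhd ns ap nb }

extension₂⇒¬maximal : ∀ ns {u v} → Extension₂ ns u v → MaximalIrredundant ns (u ∷ v ∷ []) → ⊥
extension₂⇒¬maximal ns {u} {v} (x , xu , xv , (p , pu , pv , xp) , (q , qv , qu , xq)) M =
  no-extension ns M
    (λ { (here refl) → xu ; (there (here refl)) → xv })
    (λ where
      _ (here refl) → p , (pu , λ where
        _ (here refl) n _ → n refl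
        _ (there (here refl)) _ → apart⇒¬nbhd ns pv) , apart-from-private ns xu pu xp
      _ (there (here refl)) → q , (qv , λ where
        _ (here refl) _ → apart⇒¬nbhd ns qu
        _ (there (here refl)) n _ → n refl) , apart-from-private ns xv qv xq)

-- Maximal irredundant sets of size three in K_m × K_n × K_l

Private₃ : (ns : List ℕ) → Vertex ns → Vertex ns → Vertex ns → Vertex ns → Set
Private₃ ns u v w p = InClosedNbhd ns p u × Apart ns p v × Apart ns p w

HasPrivate₃ : (ns : List ℕ) → Vertex ns → Vertex ns → Vertex ns → Set
HasPrivate₃ ns u v w = ∃[ p ] Private₃ ns u v w p

KeepsPrivate₃ : (ns : List ℕ) → Vertex ns → Vertex ns → Vertex ns → Vertex ns → Set
KeepsPrivate₃ ns x u v w = ∃[ p ] Private₃ ns u v w p × Meet ns x p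

Extension₃ : (ns : List ℕ) → Vertex ns → Vertex ns → Vertex ns → Set
Extension₃ ns u v w = ∃[ x ] (Apart ns x u × Apart ns x v × Apart ns x w) ×
  KeepsPrivate₃ ns x u v w × KeepsPrivate₃ ns x v u w × KeepsPrivate₃ ns x w u v

keeps-swap : ∀ {ns x u v w} → KeepsPrivate₃ ns x u v w → KeepsPrivate₃ ns x u w v
keeps-swap (p , (a , b , c) , d) = p , (a , c , b) , d

extension-swap : ∀ {ns u v w} → Extension₃ ns u v w → Extension₃ ns v u w
extension-swap (x , (a , b , c) , k , l , m) = x , (b , a , c) , l , k , keeps-swap m

extension-rotate : ∀ {ns u v w} → Extension₃ ns u v w → Extension₃ ns w u v
extension-rotate (x , (a , b , c) , k , l , m) = x , (c , a , b) , m , keeps-swap k , keeps-swap l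

extension₃⇒¬maximal : ∀ ns {u v w} → Extension₃ ns u v w → MaximalIrredundant ns (u ∷ v ∷ w ∷ []) → ⊥
extension₃⇒¬maximal ns {u} {v} {w}
  (x , (xu , xv , xw) , (p , (pu , pv , pw) , xp) , (q , (qv , qu , qw) , xq) , (r , (rw , ru , rv) , xr)) M =
  no-extension ns M
    (λ { (here refl) → xu ; (there (here refl)) → xv ; (there (there (here refl))) → xw })
    (λ where
      _ (here refl) → p , (pu , λ where
        _ (here refl) n _ → n refl
        _ (there (here refl)) _ → apart⇒¬nbhd ns pv
        _ (there (there (here refl))) _ → apart⇒¬nbhd ns pw) , apart-from-private ns xu pu xp
      _ (there (here refl)) → q , (qv , λ where
        _ (here refl) _ → apart⇒¬nbhd ns qu
        _ (there (here refl)) n _ → n refl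
        _ (there (there (here refl))) _ → apart⇒¬nbhd ns qw) , apart-from-private ns xv qv xq
      _ (there (there (here refl))) → r , (rw , λ where
        _ (here refl) _ → apart⇒¬nbhd ns ru
        _ (there (here refl)) _ → apart⇒¬nbhd ns rv
        _ (there (there (here refl))) n _ → n refl) , apart-from-private ns xw rw xr)

-- As `u` is dominated by `v`, it cannot be its own private neighbour.
private-of-adjacent : ∀ ns {u v p} → Adj ns u v → Apart ns p v → InClosedNbhd ns p u → Adj ns u p
private-of-adjacent ns uv pv (inj₁ refl) = ⊥-elim (adj-meet-⊥ ns uv (proj₁ pv))
private-of-adjacent ns uv pv (inj₂ h)    = h

-- Transport of extensions along embeddings of products

record Embedding (ns ns′ : List ℕ) : Set where
  field
    map   : Vertex ns → Vertex ns′
    adj   : ∀ {u v} → Adj ns u v → Adj ns′ (map u) (map v)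
    meet  : ∀ {u v} → Meet ns u v → Meet ns′ (map u) (map v)
    inj   : ∀ {u v} → map u ≡ map v → u ≡ v

  nbhd : ∀ {u v} → InClosedNbhd ns u v → InClosedNbhd ns′ (map u) (map v)
  nbhd (inj₁ refl) = inj₁ refl
  nbhd (inj₂ a)    = inj₂ (adj a)

  apart : ∀ {u v} → Apart ns u v → Apart ns′ (map u) (map v)
  apart (h , n) = meet h , n ∘ inj

  private₃ : ∀ {u v w} → HasPrivate₃ ns u v w → HasPrivate₃ ns′ (map u) (map v) (map w)
  private₃ (p , a , b , c) = map p , nbhd a , apart b , apart c

  keeps₃ : ∀ {x u v w} → KeepsPrivate₃ ns x u v w →
    KeepsPrivate₃ ns′ (map x) (map u) (map v) (map w)
  keeps₃ (p , (a , b , c) , h) = map p , (nbhd a , apart b , apart c) , meet h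

  extension₃ : ∀ {u v w} → Extension₃ ns u v w → Extension₃ ns′ (map u) (map v) (map w)
  extension₃ (x , (a , b , c) , k , l , m) =
    map x , (apart a , apart b , apart c) , keeps₃ k , keeps₃ l , keeps₃ m

swap-first : ∀ {m n ms} → Embedding (m ∷ n ∷ ms) (n ∷ m ∷ ms)
swap-first = record
  { map  = λ (a , b , u) → b , a , u
  ; adj  = λ (p , q , r) → q , p , r
  ; meet = λ { (inj₁ e) → inj₂ (inj₁ e) ; (inj₂ (inj₁ e)) → inj₁ e ; (inj₂ (inj₂ h)) → inj₂ (inj₂ h) }
  ; inj  = λ { refl → refl }
  }

under : ∀ {m ms ms′} → Embedding ms ms′ → Embedding (m ∷ ms) (m ∷ ms′)
under e = record
  { map  = λ (a , u) → a , map u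
  ; adj  = λ (p , r) → p , adj r
  ; meet = λ { (inj₁ e) → inj₁ e ; (inj₂ h) → inj₂ (meet h) }
  ; inj  = λ eq → cong₂ _,_ (cong proj₁ eq) (inj (cong proj₂ eq))
  }
  where open Embedding e

-- Explicit extensions of a triangle, an induced path and a single edge

module _ {m₁ m₂ m₃ : ℕ} where

  private
    ns : List ℕ
    ns = m₁ ∷ m₂ ∷ m₃ ∷ []

  -- Here all coordinates differ, and `x` takes one from each vertex. A private neighbour of one
  -- vertex mixes the coordinates of the other two, sharing one with `x`.
  triangle : {u v w : Vertex ns} → Adj ns u v → Adj ns u w → Adj ns v w → Extension₃ ns u v w
  triangle {a₀ , b₀ , c₀ , _} {a₁ , b₁ , c₁ , _} {a₂ , b₂ , c₂ , _}
    (a₀₁ , b₀₁ , c₀₁ , _) (a₀₂ , b₀₂ , c₀₂ , _) (a₁₂ , b₁₂ , c₁₂ , _) =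
    (a₀ , b₁ , c₂ , tt) ,
    ( (inj₁ refl , ≢₂ (≢₁ (b₀₁ ∘ sym)))
    , (inj₂ (inj₁ refl) , ≢₁ a₀₁)
    , (inj₂ (inj₂ (inj₁ refl)) , ≢₁ a₀₂)) ,
    ((a₁ , b₂ , c₂ , tt) ,
      ( inj₂ (a₀₁ , b₀₂ , c₀₂ , tt)
      , (inj₁ refl , ≢₂ (≢₁ (b₁₂ ∘ sym)))
      , (inj₂ (inj₁ refl) , ≢₁ a₁₂)) , inj₂ (inj₂ (inj₁ refl))) ,
    ((a₀ , b₂ , c₂ , tt) ,
      ( inj₂ (a₀₁ ∘ sym , b₁₂ , c₁₂ , tt)
      , (inj₁ refl , ≢₂ (≢₁ (b₀₂ ∘ sym)))
      , (inj₂ (inj₁ refl) , ≢₁ a₀₂)) , inj₁ refl) ,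
    ((a₀ , b₁ , c₁ , tt) ,
      ( inj₂ (a₀₂ ∘ sym , b₁₂ ∘ sym , c₁₂ ∘ sym , tt)
      , (inj₁ refl , ≢₂ (≢₁ (b₀₁ ∘ sym)))
      , (inj₂ (inj₁ refl) , ≢₁ a₀₁)) , inj₁ refl)

  -- The ends get explicit private neighbours, made from `v` with the second entry of the opposite
  -- end. The choice of `x` depends only on the private neighbour of the middle vertex `v`.
  path₁₂ : {u v w : Vertex ns} → Adj ns u v → Adj ns w v → HasPrivate₃ ns v u w →
    proj₁ w ≡ proj₁ u → proj₁ (proj₂ w) ≢ proj₁ (proj₂ u) → Extension₃ ns u v w
  path₁₂ {u@(a₀ , b₀ , c₀ , _)} {v@(a₁ , b₁ , c₁ , _)} {w@(_ , b , c , _)}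
    (a≢ , b≢ , c≢ , _) (_ , bv , cv , _) (p@(pa , pb , pc , _) , pv , pu , pw) refl bu = result
    where
    p-u : Private₃ ns u v w (a₁ , b , c₁ , tt)
    p-u = inj₂ (a≢ , bu ∘ sym , c≢ , tt) , (inj₁ refl , ≢₂ (≢₁ bv)) , (inj₂ (inj₁ refl) , ≢₁ (a≢ ∘ sym))

    p-w : Private₃ ns w u v (a₁ , b₀ , c₁ , tt)
    p-w = inj₂ (a≢ , bu , cv , tt) , (inj₂ (inj₁ refl) , ≢₁ (a≢ ∘ sym)) , (inj₁ refl , ≢₂ (≢₁ b≢))

    extend : KeepsPrivate₃ ns (a₀ , b , c₁ , tt) v u w → Extension₃ ns u v w
    extend k = (a₀ , b , c₁ , tt) ,
      ( (inj₁ refl , ≢₂ (≢₁ bu)) , (inj₂ (inj₂ (inj₁ refl)) , ≢₁ a≢)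
      , (inj₁ refl , ≢₂ (≢₂ (≢₁ (cv ∘ sym))))) ,
      (_ , p-u , inj₂ (inj₁ refl)) , k , (_ , p-w , inj₂ (inj₂ (inj₁ refl)))

    extend′ : pc ≡ c₀ → c ≡ c₀ → Extension₃ ns u v w
    extend′ pc≡ c≡ = (a₁ , b , c₀ , tt) ,
      ( (inj₂ (inj₂ (inj₁ refl)) , ≢₁ (a≢ ∘ sym)) , (inj₁ refl , ≢₂ (≢₁ bv))
      , (inj₂ (inj₁ refl) , ≢₁ (a≢ ∘ sym))) ,
      (_ , p-u , inj₁ refl) , (p , (pv , pu , pw) , inj₂ (inj₂ (inj₁ (sym pc≡)))) , (_ , p-w , inj₁ refl)

    result : Extension₃ ns u v w
    result with c ≟ c₀
    ... | no n = extend ((a₀ , b , c₀ , tt) ,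
      ( inj₂ (a≢ ∘ sym , bv ∘ sym , c≢ ∘ sym , tt)
      , (inj₁ refl , ≢₂ (≢₁ bu)) , (inj₁ refl , ≢₂ (≢₂ (≢₁ (n ∘ sym))))) , inj₁ refl)
    -- Now `u` and `w` differ only in the second entry, so a private neighbour `p` of `v` meeting
    -- both shares the first or the third entry with them. Each possibility has its own `x`.
    ... | yes c≡ with proj₁ pu | proj₁ pw
    ...   | inj₁ e               | _                    = extend (p , (pv , pu , pw) , inj₁ (sym e))
    ...   | inj₂ _               | inj₁ e               = extend (p , (pv , pu , pw) , inj₁ (sym e))
    ...   | inj₂ (inj₁ e)        | inj₂ (inj₁ e′)       = contradiction (trans (sym e′) e) bu
    ...   | inj₂ (inj₁ _)        | inj₂ (inj₂ (inj₁ e)) = extend′ (trans e c≡) c≡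
    ...   | inj₂ (inj₂ (inj₁ e)) | inj₂ _               = extend′ e c≡

  -- Here `w = (a₀ , b₁ , c)`. As `p` is adjacent to `u`, it meets `w` in the second or third entry;
  -- as `q` is adjacent to `v`, it meets `w` in the first or third. This gives four cases.
  edge₁₂ : {u v w : Vertex ns} → Adj ns u v → HasPrivate₃ ns u v w → HasPrivate₃ ns v u w →
    proj₁ w ≡ proj₁ u → proj₁ (proj₂ w) ≡ proj₁ (proj₂ v) → Extension₃ ns u v w
  edge₁₂ {u@(a₀ , b₀ , c₀ , _)} {v@(a₁ , b₁ , c₁ , _)} {w@(_ , _ , c , _)}
    uv@(a≢ , b≢ , c≢ , _) (p@(pa , pb , pc , _) , nb-p , pv , pw) (q@(qa , qb , qc , _) , nb-q , qu , qw)
    refl refl =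
    result (private-of-adjacent ns uv pv nb-p) (proj₁ pw)
           (private-of-adjacent ns (adj-sym ns uv) qu nb-q) (proj₁ qw)
    where
    extend : ∀ x → Meet ns x u → Meet ns x v → Apart ns x w → Meet ns x p → Meet ns x q →
      Extension₃ ns u v w
    -- A vertex meeting both ends of an edge is neither end, and `w`, meeting `u` and `v`, is its
    -- own private neighbour.
    extend x xu xv xw xp xq = x ,
      ( (xu , λ { refl → adj-meet-⊥ ns uv xv })
      , (xv , λ { refl → adj-meet-⊥ ns uv (meet-sym ns xu) }) , xw) ,
      (p , (nb-p , pv , pw) , xp) , (q , (nb-q , qu , qw) , xq) ,
      (w , (inj₁ refl , (inj₁ refl , ≢₂ (≢₁ (b≢ ∘ sym))) , (inj₂ (inj₁ refl) , ≢₁ a≢)) , proj₁ xw)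

    result : Adj ns u p → Meet ns p w → Adj ns v q → Meet ns q w → Extension₃ ns u v w
    result (n , _) (inj₁ e) _ _ = contradiction (sym e) n
    result _ _ (_ , n , _) (inj₂ (inj₁ e)) = contradiction (sym e) n
    result _ (inj₂ (inj₂ (inj₁ e))) _ (inj₂ (inj₂ (inj₁ e′))) =
      extend (a₁ , b₀ , c , tt) (inj₂ (inj₁ refl)) (inj₁ refl)
        (inj₂ (inj₂ (inj₁ refl)) , ≢₁ (a≢ ∘ sym))
        (inj₂ (inj₂ (inj₁ (sym e)))) (inj₂ (inj₂ (inj₁ (sym e′))))
    -- The entries `a₀` and `b₁` meet everything; the third entry only keeps `x` different from `w`,
    -- and one of `c₀`, `c₁` differs from `c`.
    result _ (inj₂ (inj₁ e)) _ (inj₁ e′) with c ≟ c₀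
    ... | no n =
      extend (a₀ , b₁ , c₀ , tt) (inj₁ refl) (inj₂ (inj₁ refl))
        (inj₁ refl , ≢₂ (≢₂ (≢₁ (n ∘ sym)))) (inj₂ (inj₁ (sym e))) (inj₁ (sym e′))
    ... | yes refl =
      extend (a₀ , b₁ , c₁ , tt) (inj₁ refl) (inj₂ (inj₁ refl))
        (inj₁ refl , ≢₂ (≢₂ (≢₁ (c≢ ∘ sym)))) (inj₂ (inj₁ (sym e))) (inj₁ (sym e′))
    -- If `c` differs from `c₁`, the entry `c₁` separates `x` from `w` and `pb` meets `p`. If
    -- `c = c₁`, that entry meets `p` and `b₀` does the separating.
    result _ (inj₂ (inj₂ (inj₁ e))) _ (inj₁ e′) with c ≟ c₁
    ... | no n =
      extend (a₀ , pb , c₁ , tt) (inj₁ refl) (inj₂ (inj₂ (inj₁ refl)))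
        (inj₁ refl , ≢₂ (≢₂ (≢₁ (n ∘ sym)))) (inj₂ (inj₁ refl)) (inj₁ (sym e′))
    ... | yes refl =
      extend (a₀ , b₀ , c₁ , tt) (inj₁ refl) (inj₂ (inj₂ (inj₁ refl)))
        (inj₁ refl , ≢₂ (≢₁ b≢)) (inj₂ (inj₂ (inj₁ (sym e)))) (inj₁ (sym e′))
    result _ (inj₂ (inj₁ e)) _ (inj₂ (inj₂ (inj₁ e′))) with c ≟ c₀
    ... | no n =
      extend (qa , b₁ , c₀ , tt) (inj₂ (inj₂ (inj₁ refl))) (inj₂ (inj₁ refl))
        (inj₂ (inj₁ refl) , ≢₂ (≢₂ (≢₁ (n ∘ sym)))) (inj₂ (inj₁ (sym e))) (inj₁ refl)
    ... | yes refl =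
      extend (a₁ , b₁ , c₀ , tt) (inj₂ (inj₂ (inj₁ refl))) (inj₂ (inj₁ refl))
        (inj₂ (inj₁ refl) , ≢₁ (a≢ ∘ sym)) (inj₂ (inj₁ (sym e))) (inj₂ (inj₂ (inj₁ (sym e′))))

-- Coordinate permutations

record Isomorphism (ns ns′ : List ℕ) : Set where
  field
    to      : Embedding ns ns′
    from    : Embedding ns′ ns
    from-to : ∀ u → Embedding.map from (Embedding.map to u) ≡ u

swap₁₂ : ∀ {m n ms} → Isomorphism (m ∷ n ∷ ms) (n ∷ m ∷ ms)
swap₁₂ = record { to = swap-first ; from = swap-first ; from-to = λ _ → refl }

swap₂₃ : ∀ {l m n ms} → Isomorphism (l ∷ m ∷ n ∷ ms) (l ∷ n ∷ m ∷ ms)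
swap₂₃ = record { to = under swap-first ; from = under swap-first ; from-to = λ _ → refl }

EdgeExtends : (ns : List ℕ) → (Vertex ns → Vertex ns → Vertex ns → Set) → Set
EdgeExtends ns Q = ∀ {u v w} → Adj ns u v → HasPrivate₃ ns u v w → HasPrivate₃ ns v u w →
  Q u v w → Extension₃ ns u v w

edgeExtends-iso : ∀ {ns ns′ Q Q′} (φ : Isomorphism ns ns′) →
  let t = Embedding.map (Isomorphism.to φ) in
  (∀ u v w → Q u v w → Q′ (t u) (t v) (t w)) →
  EdgeExtends ns′ Q′ → EdgeExtends ns Q
edgeExtends-iso {ns} φ f claim {u} {v} {w} uv pu pv q =
  subst (λ z → Extension₃ ns z v w) (from-to u)
  (subst (λ z → Extension₃ ns (g (t u)) z w) (from-to v)
  (subst (Extension₃ ns (g (t u)) (g (t v))) (from-to w)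
  (extension₃ from (claim (adj to uv) (private₃ to pu) (private₃ to pv) (f u v w q)))))
  where
  open Isomorphism φ
  open Embedding
  t = map to
  g = map from

Agree : ∀ {m₁ m₂ m₃} → Fin 3 → Vertex (m₁ ∷ m₂ ∷ m₃ ∷ []) → Vertex (m₁ ∷ m₂ ∷ m₃ ∷ []) → Set
Agree 0F (a , _)          (a′ , _)          = a ≡ a′
Agree 1F (_ , b , _)      (_ , b′ , _)      = b ≡ b′
Agree 2F (_ , _ , c , _)  (_ , _ , c′ , _)  = c ≡ c′

-- With u adjacent to v: either w is adjacent to neither of them, or u – v – w is an induced path.
EdgeOrPath : ∀ {m₁ m₂ m₃} → Fin 3 → Fin 3 → (u v w : Vertex (m₁ ∷ m₂ ∷ m₃ ∷ [])) → Set
EdgeOrPath {m₁} {m₂} {m₃} i j u v w =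
  Agree i w u × (Agree j w v ⊎ (Adj (m₁ ∷ m₂ ∷ m₃ ∷ []) w v × ¬ Agree j w u))

-- Agreement in coordinate `j` has to be reflected as well as preserved, since the path case denies
-- it for `w` and `u`.
edgeOrPath-iso : ∀ {m₁ m₂ m₃ n₁ n₂ n₃} i j i′ j′
  (φ : Isomorphism (m₁ ∷ m₂ ∷ m₃ ∷ []) (n₁ ∷ n₂ ∷ n₃ ∷ [])) →
  let t = Embedding.map (Isomorphism.to φ) in
  (∀ u w → Agree i w u → Agree i′ (t w) (t u)) →
  (∀ v w → Agree j w v → Agree j′ (t w) (t v)) →
  (∀ u w → Agree j′ (t w) (t u) → Agree j w u) →
  EdgeExtends (n₁ ∷ n₂ ∷ n₃ ∷ []) (EdgeOrPath i′ j′) →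
  EdgeExtends (m₁ ∷ m₂ ∷ m₃ ∷ []) (EdgeOrPath i j)
edgeOrPath-iso {m₁} {m₂} {m₃} i j i′ j′ φ f g g⁻ =
  edgeExtends-iso {Q = EdgeOrPath i j} {Q′ = EdgeOrPath i′ j′} φ transfer
  where
  open Embedding (Isomorphism.to φ)

  transfer : (u v w : Vertex (m₁ ∷ m₂ ∷ m₃ ∷ [])) → EdgeOrPath i j u v w →
    EdgeOrPath i′ j′ (map u) (map v) (map w)
  transfer u v w (a , inj₁ b)       = f u w a , inj₁ (g v w b)
  transfer u v w (a , inj₂ (h , c)) = f u w a , inj₂ (adj {w} {v} h , c ∘ g⁻ u w)

edgeOrPath₁₂ : ∀ {m₁ m₂ m₃} → EdgeExtends (m₁ ∷ m₂ ∷ m₃ ∷ []) (EdgeOrPath 0F 1F)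
edgeOrPath₁₂ uv pu pv (e , inj₁ e′)       = edge₁₂ uv pu pv e e′
edgeOrPath₁₂ uv pu pv (e , inj₂ (wv , n)) = path₁₂ uv wv pv e n

edgeOrPath₂₁ : ∀ {m₁ m₂ m₃} → EdgeExtends (m₁ ∷ m₂ ∷ m₃ ∷ []) (EdgeOrPath 1F 0F)
edgeOrPath₂₁ = edgeOrPath-iso 1F 0F 0F 1F swap₁₂ (λ _ _ e → e) (λ _ _ e → e) (λ _ _ e → e) edgeOrPath₁₂

edgeOrPath₁₃ : ∀ {m₁ m₂ m₃} → EdgeExtends (m₁ ∷ m₂ ∷ m₃ ∷ []) (EdgeOrPath 0F 2F)
edgeOrPath₁₃ = edgeOrPath-iso 0F 2F 0F 1F swap₂₃ (λ _ _ e → e) (λ _ _ e → e) (λ _ _ e → e) edgeOrPath₁₂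

edgeOrPath₃₁ : ∀ {m₁ m₂ m₃} → EdgeExtends (m₁ ∷ m₂ ∷ m₃ ∷ []) (EdgeOrPath 2F 0F)
edgeOrPath₃₁ = edgeOrPath-iso 2F 0F 1F 0F swap₂₃ (λ _ _ e → e) (λ _ _ e → e) (λ _ _ e → e) edgeOrPath₂₁

-- Two adjacent transpositions generate all permutations of three coordinates, so every ordered pair
-- reduces to `0F`, `1F`.
edgeOrPath : ∀ {m₁ m₂ m₃} i j → i ≢ j → EdgeExtends (m₁ ∷ m₂ ∷ m₃ ∷ []) (EdgeOrPath i j)
edgeOrPath 0F 1F _ = edgeOrPath₁₂
edgeOrPath 0F 2F _ = edgeOrPath₁₃
edgeOrPath 1F 0F _ = edgeOrPath₂₁
edgeOrPath 2F 0F _ = edgeOrPath₃₁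
edgeOrPath 1F 2F _ =
  edgeOrPath-iso 1F 2F 0F 2F swap₁₂ (λ _ _ e → e) (λ _ _ e → e) (λ _ _ e → e) edgeOrPath₁₃
edgeOrPath 2F 1F _ =
  edgeOrPath-iso 2F 1F 2F 0F swap₁₂ (λ _ _ e → e) (λ _ _ e → e) (λ _ _ e → e) edgeOrPath₃₁
edgeOrPath 0F 0F n = contradiction refl n
edgeOrPath 1F 1F n = contradiction refl n
edgeOrPath 2F 2F n = contradiction refl n

-- Case analysis on the graph induced by three vertices

module _ {m₁ m₂ m₃ : ℕ} where

  private
    ns : List ℕ
    ns = m₁ ∷ m₂ ∷ m₃ ∷ []

  meet⇒agree : {x y : Vertex ns} → Meet ns x y → ∃[ i ] Agree i x y
  meet⇒agree (inj₁ e)               = 0F , e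
  meet⇒agree (inj₂ (inj₁ e))        = 1F , e
  meet⇒agree (inj₂ (inj₂ (inj₁ e))) = 2F , e

  adj⇒¬agree : {x y : Vertex ns} → Adj ns x y → ∀ i → ¬ Agree i x y
  adj⇒¬agree (p , _)         0F = p
  adj⇒¬agree (_ , p , _)     1F = p
  adj⇒¬agree (_ , _ , p , _) 2F = p

  agree-euclidean : {x y z : Vertex ns} → ∀ i → Agree i x y → Agree i x z → Agree i y z
  agree-euclidean 0F e e′ = trans (sym e) e′
  agree-euclidean 1F e e′ = trans (sym e) e′
  agree-euclidean 2F e e′ = trans (sym e) e′

  ≢⇒¬agree : {x y : Vertex ns} → x ≢ y → ∃[ i ] ¬ Agree i x y
  ≢⇒¬agree {a , b , c , _} {a′ , b′ , c′ , _} x≢y with a ≟ a′ | b ≟ b′ | c ≟ c′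
  ... | no n     | _        | _        = 0F , n
  ... | yes _    | no n     | _        = 1F , n
  ... | yes _    | yes _    | no n     = 2F , n
  ... | yes refl | yes refl | yes refl = contradiction refl x≢y

  path : {u v w : Vertex ns} → Adj ns u v → w ≢ u → HasPrivate₃ ns u v w → HasPrivate₃ ns v u w →
    Meet ns w u → Adj ns w v → Extension₃ ns u v w
  path uv w≢u pu pv wu wv with meet⇒agree wu | ≢⇒¬agree w≢u
  ... | i , e | j , n = edgeOrPath i j (λ { refl → n e }) uv pu pv (e , inj₂ (wv , n))

  edge : {u v w : Vertex ns} → Adj ns u v → w ≢ u → w ≢ v →
    HasPrivate₃ ns u v w → HasPrivate₃ ns v u w → Extension₃ ns u v w
  edge {u} {v} {w} uv w≢u w≢v pu pv with adj-or-meet ns w u | adj-or-meet ns w v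
  ... | inj₁ wu | inj₁ wv = triangle uv (adj-sym ns wu) (adj-sym ns wv)
  ... | inj₁ wu | inj₂ wv = extension-swap (path (adj-sym ns uv) w≢v pv pu wv wu)
  ... | inj₂ wu | inj₁ wv = path uv w≢u pu pv wu wv
  ... | inj₂ wu | inj₂ wv with meet⇒agree wu | meet⇒agree wv
  ...   | i , e | j , e′ = edgeOrPath i j
    -- If `w` agreed with `u` and `v` in the same coordinate, the adjacent `u` and `v` would agree
    -- there.
    (λ { refl → adj⇒¬agree uv i (agree-euclidean i e e′) }) uv pu pv (e , inj₁ e′)

  private-swap : ∀ {u v w} → HasPrivate₃ ns u v w → HasPrivate₃ ns u w v
  private-swap (p , a , b , c) = p , a , c , b

  -- Any edge can be moved to the first two places. Without edges each vertex is its own private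
  -- neighbour, so every undominated `x` works; `avoid₃` gives one, as `3 + 3 ≤ 7`.
  extension₃ : 2 ≤ m₁ → 2 ≤ m₂ → 2 ≤ m₃ → {u v w : Vertex ns} → u ≢ v → u ≢ w → v ≢ w →
    HasPrivate₃ ns u v w → HasPrivate₃ ns v u w → HasPrivate₃ ns w u v → Extension₃ ns u v w
  extension₃ q₁ q₂ q₃ {u} {v} {w} u≢v u≢w v≢w pu pv pw
    with adj-or-meet ns u v | adj-or-meet ns u w | adj-or-meet ns v w
  ... | inj₁ uv | _       | _       = edge uv (u≢w ∘ sym) (v≢w ∘ sym) pu pv
  ... | inj₂ _  | inj₁ uw | _       =
    extension-swap (extension-rotate (edge uw (u≢v ∘ sym) v≢w (private-swap pu) pw))
  ... | inj₂ _  | inj₂ _  | inj₁ vw =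
    extension-rotate (edge vw u≢v u≢w (private-swap pv) (private-swap pw))
  ... | inj₂ uv | inj₂ uw | inj₂ vw
    with undominated-small {D = u ∷ v ∷ w ∷ []} (avoid₃ q₁ q₂ q₃) ≤-refl (n≤1+n 6)
  ...   | x , x-free = x , (xu , xv , xw) ,
    (u , (inj₁ refl , (uv , u≢v) , (uw , u≢w)) , proj₁ xu) ,
    (v , (inj₁ refl , (meet-sym ns uv , u≢v ∘ sym) , (vw , v≢w)) , proj₁ xv) ,
    (w , (inj₁ refl , (meet-sym ns uw , u≢w ∘ sym) , (meet-sym ns vw , v≢w ∘ sym)) , proj₁ xw)
    where
    xu = x-free (here refl)
    xv = x-free (there (here refl))
    xw = x-free (there (there (here refl)))

-- Dominating irredundant sets

-- A private neighbour of `v` in a larger irredundant set is dominated by some `d` in `S`; privacy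
-- forces `d = v`, so `v` was already in `S`.
dominating⇒maximal : ∀ ns {S} → Irredundant ns S →
  (∀ x → ∃[ d ] d ∈ S × InClosedNbhd ns x d) → MaximalIrredundant ns S
dominating⇒maximal ns irr dom = irr , λ S′ S⊆S′ irr′ {v} v∈S′ → helper S⊆S′ v∈S′ (irr′ v v∈S′)
  where
  helper : ∀ {S′ v} → (∀ {d} → d ∈ _ → d ∈ S′) → v ∈ S′ → ∃[ p ] PrivateNbr ns S′ v p → v ∈ _
  helper {v = v} S⊆S′ v∈S′ (p , _ , only) with dom p
  ... | d , d∈S , nb with vertex-≟ ns d v
  ...   | yes refl = d∈S
  ...   | no n     = ⊥-elim (only d (S⊆S′ d∈S) n nb)

independent⇒irredundant : ∀ ns {S} → All (λ u → All (Meet ns u) S) S → Irredundant ns S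
independent⇒irredundant ns all v v∈S = v , inj₁ refl , λ w w∈S w≢v →
  apart⇒¬nbhd ns (All.lookup (All.lookup all v∈S) w∈S , w≢v ∘ sym)

-- Exact values for at most three factors

ir-one : ∀ m → 2 ≤ m → IrNumberIs (m ∷ []) 1
ir-one (suc m) 2≤m =
  ((zero , tt) ∷ [] , [] ∷ [] , dominating⇒maximal _
    (independent⇒irredundant _ ((inj₁ refl ∷ []) ∷ [])) dom , refl) ,
  λ S _ M → *-cancelˡ-≤ 2 (maximalIrredundant-bound _ 0 undom S M)
  where
  dom : ∀ x → ∃[ d ] d ∈ (zero , tt) ∷ [] × InClosedNbhd (suc m ∷ []) x d
  dom (zero , _)  = _ , here refl , inj₁ refl
  dom (suc _ , _) = _ , here refl , inj₂ ((λ ()) , tt)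

  undom : ∀ D → length D ≤ 0 → ∃[ x ] Undominated (suc m ∷ []) x D
  undom [] _ = (zero , tt) , λ ()

2-bound : ∀ {m n} → 2 ≤ m → 2 ≤ n → ∀ S → MaximalIrredundant (m ∷ n ∷ []) S → 2 ≤ length S
2-bound p q S M = *-cancelˡ-< 2 1 (length S) (maximalIrredundant-bound _ 1 (λ D h →
  undominated-small (avoid₂ p q) (≤-trans h (n≤1+n 1)) (≤-trans (+-mono-≤ h h) (n≤1+n 2))) S M)

ir-two : ∀ n → 2 ≤ n → IrNumberIs (2 ∷ n ∷ []) 2
ir-two (suc n) 2≤n =
  (S , ((λ ()) ∷ []) ∷ [] ∷ [] , dominating⇒maximal _ (independent⇒irredundant _
      ((inj₁ refl ∷ inj₂ (inj₁ refl) ∷ []) ∷ (inj₂ (inj₁ refl) ∷ inj₁ refl ∷ []) ∷ [])) dom , refl) ,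
  λ S _ → 2-bound ≤-refl 2≤n S
  where
  S : List (Vertex (2 ∷ suc n ∷ []))
  -- Both values of the first coordinate occur over one second entry, so a vertex off that line is
  -- adjacent to the member with the opposite first entry.
  S = (zero , zero , tt) ∷ (suc zero , zero , tt) ∷ []

  dom : ∀ x → ∃[ d ] d ∈ S × InClosedNbhd (2 ∷ suc n ∷ []) x d
  dom (zero , zero , _)      = _ , here refl , inj₁ refl
  dom (suc zero , zero , _)  = _ , there (here refl) , inj₁ refl
  dom (zero , suc _ , _)     = _ , there (here refl) , inj₂ ((λ ()) , (λ ()) , tt)
  dom (suc zero , suc _ , _) = _ , here refl , inj₂ ((λ ()) , (λ ()) , tt)

ir-two-large : ∀ m n → 3 ≤ m → 3 ≤ n → IrNumberIs (m ∷ n ∷ []) 3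
ir-two-large (suc (suc (suc m))) (suc (suc (suc n))) 3≤m@(s≤s (s≤s (s≤s _))) 3≤n@(s≤s (s≤s (s≤s _))) =
  (S , ((λ ()) ∷ (λ ()) ∷ []) ∷ ((λ ()) ∷ []) ∷ [] ∷ [] , dominating⇒maximal ns irr dom , refl) , bound
  where
  ns : List ℕ
  ns = 3 + m ∷ 3 + n ∷ []

  S : List (Vertex ns)
  -- Two coordinates cannot use all three of the values 0, 1, 2, so every vertex is adjacent to a
  -- diagonal one; off-diagonal vertices serve as private neighbours.
  S = (zero , zero , tt) ∷ (suc zero , suc zero , tt) ∷ (suc (suc zero) , suc (suc zero) , tt) ∷ []

  irr : Irredundant ns S
  irr _ (here refl) = (suc zero , suc (suc zero) , tt) , inj₂ ((λ ()) , (λ ()) , tt) , λ where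
    _ (here refl) k _ → k refl
    _ (there (here refl)) _ → apart⇒¬nbhd ns (inj₁ refl , λ ())
    _ (there (there (here refl))) _ → apart⇒¬nbhd ns (inj₂ (inj₁ refl) , λ ())
  irr _ (there (here refl)) = (zero , suc (suc zero) , tt) , inj₂ ((λ ()) , (λ ()) , tt) , λ where
    _ (here refl) _ → apart⇒¬nbhd ns (inj₁ refl , λ ())
    _ (there (here refl)) k _ → k refl
    _ (there (there (here refl))) _ → apart⇒¬nbhd ns (inj₂ (inj₁ refl) , λ ())
  irr _ (there (there (here refl))) = (zero , suc zero , tt) , inj₂ ((λ ()) , (λ ()) , tt) , λ where
    _ (here refl) _ → apart⇒¬nbhd ns (inj₁ refl , λ ())
    _ (there (here refl)) _ → apart⇒¬nbhd ns (inj₂ (inj₁ refl) , λ ())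
    _ (there (there (here refl))) k _ → k refl

  dom : ∀ x → ∃[ d ] d ∈ S × InClosedNbhd ns x d
  dom (suc _ , suc _ , _)      = _ , here refl , inj₂ ((λ ()) , (λ ()) , tt)
  dom (zero , zero , _)        = _ , here refl , inj₁ refl
  dom (zero , suc zero , _)    = _ , there (there (here refl)) , inj₂ ((λ ()) , (λ ()) , tt)
  dom (zero , suc (suc _) , _)        = _ , there (here refl) , inj₂ ((λ ()) , (λ ()) , tt)
  dom (suc zero , zero , _)    = _ , there (there (here refl)) , inj₂ ((λ ()) , (λ ()) , tt)
  dom (suc (suc _) , zero , _) = _ , there (here refl) , inj₂ ((λ ()) , (λ ()) , tt)

  bound : ∀ S → Unique S → MaximalIrredundant ns S → 3 ≤ length S
  bound [] _ M with () ← 2-bound (s≤s (s≤s z≤n)) (s≤s (s≤s z≤n)) [] M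
  bound (u ∷ []) _ M with s≤s () ← 2-bound (s≤s (s≤s z≤n)) (s≤s (s≤s z≤n)) (u ∷ []) M
  bound (u ∷ v ∷ []) ((u≢v ∷ []) ∷ _) M = ⊥-elim (extension₂⇒¬maximal ns (extension₂ 3≤m 3≤n u v u≢v) M)
  bound (_ ∷ _ ∷ _ ∷ _) _ _ = s≤s (s≤s (s≤s z≤n))

ir-three : ∀ l m n → 2 ≤ l → 2 ≤ m → 2 ≤ n → IrNumberIs (l ∷ m ∷ n ∷ []) 4
ir-three (suc (suc l)) (suc (suc m)) (suc (suc n))
  2≤l@(s≤s (s≤s _)) 2≤m@(s≤s (s≤s _)) 2≤n@(s≤s (s≤s _)) =
  (S , ((λ ()) ∷ (λ ()) ∷ (λ ()) ∷ []) ∷ ((λ ()) ∷ (λ ()) ∷ []) ∷ ((λ ()) ∷ []) ∷ [] ∷ [] ,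
    dominating⇒maximal ns (independent⇒irredundant ns
      ( (at₁ ∷ at₁ ∷ at₂ ∷ at₃ ∷ [])
      ∷ (at₁ ∷ at₁ ∷ at₃ ∷ at₂ ∷ [])
      ∷ (at₂ ∷ at₃ ∷ at₁ ∷ at₁ ∷ [])
      ∷ (at₃ ∷ at₂ ∷ at₁ ∷ at₁ ∷ []) ∷ [])) dom , refl) , bound
  where
  ns : List ℕ
  ns = 2 + l ∷ 2 + m ∷ 2 + n ∷ []

  S : List (Vertex ns)
  -- These are the binary vectors of even weight. Distinct ones share exactly one coordinate, and
  -- the complement of an odd binary vector is even; an entry above 1 leaves a free choice of
  -- parity.
  S = (zero , zero , zero , tt) ∷ (zero , suc zero , suc zero , tt)
    ∷ (suc zero , zero , suc zero , tt) ∷ (suc zero , suc zero , zero , tt) ∷ []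

  at₁ : ∀ {a u v} → Meet ns (a , u) (a , v)
  at₁ = inj₁ refl

  at₂ : ∀ {a a′ b u v} → Meet ns (a , b , u) (a′ , b , v)
  at₂ = inj₂ (inj₁ refl)

  at₃ : ∀ {a a′ b b′ c u v} → Meet ns (a , b , c , u) (a′ , b′ , c , v)
  at₃ = inj₂ (inj₂ (inj₁ refl))

  adjacent : ∀ {a b c a′ b′ c′} → a′ ≢ a → b′ ≢ b → c′ ≢ c →
    InClosedNbhd ns (a , b , c , tt) (a′ , b′ , c′ , tt)
  adjacent p q r = inj₂ (p , q , r , tt)

  dom : ∀ x → ∃[ d ] d ∈ S × InClosedNbhd ns x d
  dom (suc _ , suc _ , suc _ , _)         = _ , here refl , adjacent (λ ()) (λ ()) (λ ())
  dom (suc _ , zero , zero , _)           = _ , there (here refl) , adjacent (λ ()) (λ ()) (λ ())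
  dom (zero , suc _ , zero , _)           = _ , there (there (here refl)) , adjacent (λ ()) (λ ()) (λ ())
  dom (zero , zero , suc _ , _)           = _ , there (there (there (here refl))) , adjacent (λ ()) (λ ()) (λ ())
  dom (zero , zero , zero , _)            = _ , here refl , inj₁ refl
  dom (zero , suc zero , suc zero , _)    = _ , there (here refl) , inj₁ refl
  dom (suc zero , zero , suc zero , _)    = _ , there (there (here refl)) , inj₁ refl
  dom (suc zero , suc zero , zero , _)    = _ , there (there (there (here refl))) , inj₁ refl
  dom (zero , suc (suc _) , suc _ , _)    = _ , there (there (there (here refl))) , adjacent (λ ()) (λ ()) (λ ())
  dom (zero , suc zero , suc (suc _) , _) = _ , there (there (here refl)) , adjacent (λ ()) (λ ()) (λ ())
  dom (suc (suc _) , zero , suc _ , _)    = _ , there (there (there (here refl))) , adjacent (λ ()) (λ ()) (λ ())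
  dom (suc zero , zero , suc (suc _) , _) = _ , there (here refl) , adjacent (λ ()) (λ ()) (λ ())
  dom (suc (suc _) , suc _ , zero , _)    = _ , there (there (here refl)) , adjacent (λ ()) (λ ()) (λ ())
  dom (suc zero , suc (suc _) , zero , _) = _ , there (here refl) , adjacent (λ ()) (λ ()) (λ ())

  bound : ∀ S → Unique S → MaximalIrredundant ns S → 4 ≤ length S
  -- Taking `N = 3` gives `5 ≤ 2 |S|`, hence `3 ≤ |S|`; size three is then excluded by `extension₃`.
  bound S unique M = go S unique M (*-cancelˡ-< 2 2 (length S) (maximalIrredundant-bound ns 3
    (λ D h → undominated-small (avoid₃ 2≤l 2≤m 2≤n) h (≤-trans (+-mono-≤ h h) (n≤1+n 6))) S M))
    where
    private-in : ∀ {S} → MaximalIrredundant ns S → ∀ {v} → v ∈ S →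
      ∃[ p ] InClosedNbhd ns p v × (∀ {w} → w ∈ S → w ≢ v → Apart ns p w)
    private-in (irr , _) v∈S with irr _ v∈S
    ... | p , nb , only = p , nb , λ w∈S w≢v → ¬nbhd⇒apart ns (only _ w∈S w≢v)

    go : ∀ S → Unique S → MaximalIrredundant ns S → 3 ≤ length S → 4 ≤ length S
    go (_ ∷ _ ∷ _ ∷ _ ∷ _) _ _ _ = s≤s (s≤s (s≤s (s≤s z≤n)))
    go (u ∷ v ∷ w ∷ []) ((u≢v ∷ u≢w ∷ []) ∷ (v≢w ∷ []) ∷ _) M _
      with private-in M (here refl) | private-in M (there (here refl))
         | private-in M (there (there (here refl)))
    ... | p , pu , p-only | q , qv , q-only | r , rw , r-only =
      ⊥-elim (extension₃⇒¬maximal ns (extension₃ 2≤l 2≤m 2≤n u≢v u≢w v≢w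
        (p , pu , p-only (there (here refl)) (u≢v ∘ sym) , p-only (there (there (here refl))) (u≢w ∘ sym))
        (q , qv , q-only (here refl) u≢v , q-only (there (there (here refl))) (v≢w ∘ sym))
        (r , rw , r-only (here refl) u≢w , r-only (there (here refl)) v≢w)) M)
    go [] _ _ ()
    go (_ ∷ []) _ _ (s≤s ())
    go (_ ∷ _ ∷ []) _ _ (s≤s (s≤s ()))

-- Combination of the cases by number of factors

linked-all : ∀ {k n ms} → k ≤ n → Linked _≤_ (n ∷ ms) → All (k ≤_) (n ∷ ms)
linked-all p [-]     = p ∷ []
linked-all p (q ∷ l) = p ∷ linked-all (≤-trans p q) l

theorem4p3 : (n₁ : ℕ) (rest : List ℕ) (h : 2 ≤ n₁) → Linked _≤_ (n₁ ∷ rest) →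
    (length (n₁ ∷ rest) ≡ 1 → IrNumberIs (n₁ ∷ rest) 1) ×
    (length (n₁ ∷ rest) ≡ 2 → n₁ ≡ 2 → IrNumberIs (n₁ ∷ rest) 2) ×
    (length (n₁ ∷ rest) ≡ 2 → 3 ≤ n₁ → IrNumberIs (n₁ ∷ rest) 3) ×
    (length (n₁ ∷ rest) ≡ 3 → IrNumberIs (n₁ ∷ rest) 4) ×
    (4 ≤ length (n₁ ∷ rest) →
    (S : List (Vertex (n₁ ∷ rest))) → Unique S → MaximalIrredundant (n₁ ∷ rest) S →
    length (n₁ ∷ rest) + _/_ (length (n₁ ∷ rest) ∸ 1) (n₁ ∸ 1) {{pred-nonZero h}} + 2
    ≤ 2 * length S)
theorem4p3 n₁ rest h linked =
  one rest , two-small rest linked , two-large rest linked , three rest (linked-all h linked) ,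
  four h (linked-all h linked)
  where
  one : ∀ ms → length (n₁ ∷ ms) ≡ 1 → IrNumberIs (n₁ ∷ ms) 1
  one [] _ = ir-one n₁ h

  two-small : ∀ ms → Linked _≤_ (n₁ ∷ ms) → length (n₁ ∷ ms) ≡ 2 → n₁ ≡ 2 → IrNumberIs (n₁ ∷ ms) 2
  two-small (n ∷ []) (2≤n ∷ _) _ refl = ir-two n 2≤n

  two-large : ∀ ms → Linked _≤_ (n₁ ∷ ms) → length (n₁ ∷ ms) ≡ 2 → 3 ≤ n₁ → IrNumberIs (n₁ ∷ ms) 3
  two-large (n ∷ []) (n₁≤n ∷ _) _ 3≤n₁ = ir-two-large n₁ n 3≤n₁ (≤-trans 3≤n₁ n₁≤n)

  three : ∀ ms → All (2 ≤_) (n₁ ∷ ms) → length (n₁ ∷ ms) ≡ 3 → IrNumberIs (n₁ ∷ ms) 4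
  three (m ∷ n ∷ []) (p ∷ q ∷ r ∷ []) _ = ir-three n₁ m n p q r

  four : ∀ {n} (h : 2 ≤ n) → All (2 ≤_) (n ∷ rest) → 4 ≤ length (n ∷ rest) →
    ∀ S → Unique S → MaximalIrredundant (n ∷ rest) S →
    suc (length rest) + _/_ (length rest) (n ∸ 1) {{pred-nonZero h}} + 2 ≤ 2 * length S
  -- Matching on the bound exposes `n` as a successor, so `n ∸ 1` reduces to the divisor in
  -- `undominated-large`.
  four (s≤s (s≤s _)) (_ ∷ all≥2) 4≤t S _ M =
    maximalIrredundant-bound _ _ (undominated-large all≥2 (s≤s⁻¹ 4≤t)) S M
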